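{- For every prime power $q$ and every integer $n \geq 1$, $\chi(\Gamma_{l-i}(M_n(F_q))) = \omega(\Gamma_{l-i}(M_n(F_q))) = n+1$.
   Context: $F_q$ is the finite field with $q$ elements and $M_n(F_q)$ is the ring of all $n\times n$ matrices over $F_q$. For $X \in M_n(F_q)$, $[X] = \{AX : A \in M_n(F_q)\}$ is the left ideal generated by $X$. The undirected left-ideal relation graph $\Gamma_{l-i}(M_n(F_q))$ is the simple graph with vertex set $M_n(F_q)$ in which two distinct vertices $X, Y$ are adjacent if and only if $[X] \subset [Y]$ or $[Y] \subset [X]$, where $\subset$ denotes proper containment. $\chi(\Gamma)$ is the chromatic number and $\omega(\Gamma)$ the clique number of a graph $\Gamma$. -}

module Defs where

open import Level using (Level; _⊔_; suc; 0ℓ)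
open import Algebra.Bundles using (CommutativeRing)
import Algebra.Definitions as AlgebraDefinitions
import Algebra.Properties.CommutativeMonoid.Sum as Sum
open import Data.Fin.Base using (Fin)
open import Data.Nat.Base as ℕ using (ℕ; _≤_)
open import Data.Nat.Primality using (Prime)
open import Data.Product.Base using (_×_; _,_; ∃-syntax; Σ-syntax; proj₁)
open import Data.Sum.Base as ⊎ using (_⊎_)
open import Data.Vec.Functional using (Vector)
open import Data.Vec.Functional.Relation.Binary.Equality.Setoid using (≋-setoid)
open import Function.Bundles using (Func; Bijection)
open import Function.Base using (_∘_)
open import Relation.Binary.Bundles using (Setoid)
open import Relation.Binary.Core using (Rel)
open import Relation.Binary.Definitions using (Irreflexive; Symmetric; _Respects₂_)
open import Relation.Binary.PropositionalEquality.Core using (_≡_; _≢_)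
open import Relation.Binary.PropositionalEquality.Properties using (setoid)
open import Relation.Nullary.Negation using (¬_)
open import Relation.Unary using (Pred; _⊆_; _⊂_)

private
  variable
    c ℓ e : Level

PrimePower : Pred ℕ 0ℓ
PrimePower q = ∃[ p ] ∃[ k ] (Prime p × 1 ≤ k × q ≡ p ℕ.^ k)

record FiniteField (q : ℕ) (c ℓ : Level) : Set (suc (c ⊔ ℓ)) where
  field
    commutativeRing : CommutativeRing c ℓ

  open CommutativeRing commutativeRing public
    renaming (setoid to fieldSetoid)
  open AlgebraDefinitions _≈_ using (Invertible)

  field
    1≉0         : ¬ (1# ≈ 0#)
    ≉0⇒inverse  : ∀ x → ¬ (x ≈ 0#) → Invertible 1# _*_ x
    cardinality : Bijection fieldSetoid (setoid (Fin q))

-- Vertices are compared by the setoid equality, so adjacency has to respect it.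
record SimpleGraph (c ℓ e : Level) : Set (suc (c ⊔ ℓ ⊔ e)) where
  field
    vertices : Setoid c ℓ

  open Setoid vertices public using () renaming (Carrier to V; _≈_ to _≈ᵛ_)

  field
    Adj    : Rel V e
    resp   : Adj Respects₂ _≈ᵛ_
    symm   : Symmetric Adj
    irrefl : Irreflexive _≈ᵛ_ Adj

module _ (Γ : SimpleGraph c ℓ e) where
  open SimpleGraph Γ

  Colourable : Pred ℕ _
  Colourable k = Σ[ f ∈ Func vertices (setoid (Fin k)) ]
    (∀ {x y} → Adj x y → Func.to f x ≢ Func.to f y)

  -- Irreflexivity of adjacency makes the k members of the clique distinct.
  HasClique : Pred ℕ _
  HasClique k = Σ[ v ∈ (Fin k → V) ] (∀ {i j} → i ≢ j → Adj (v i) (v j))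

  IsChromaticNumber : Pred ℕ _
  IsChromaticNumber k = Colourable k × (∀ m → Colourable m → k ≤ m)

  IsCliqueNumber : Pred ℕ _
  IsCliqueNumber k = HasClique k × (∀ m → HasClique m → m ≤ k)

module Matrices (R : CommutativeRing c ℓ) (n : ℕ) where
  open CommutativeRing R using (Carrier; _*_; +-commutativeMonoid)
  private module R = CommutativeRing R
  open Sum +-commutativeMonoid using (sum-syntax; sum-cong-≋)

  Matrix : Set c
  Matrix = Vector (Vector Carrier n) n

  matrixSetoid : Setoid c ℓ
  matrixSetoid = ≋-setoid (≋-setoid R.setoid n) n

  open Setoid matrixSetoid public using () renaming
    (_≈_ to _≈ᴹ_; sym to ≈ᴹ-sym; trans to ≈ᴹ-trans)

  infixl 7 _*ᴹ_
  _*ᴹ_ : Matrix → Matrix → Matrix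
  (A *ᴹ B) i j = ∑[ k < n ] (A i k * B k j)

  *ᴹ-congˡ : ∀ A {X Y} → X ≈ᴹ Y → A *ᴹ X ≈ᴹ A *ᴹ Y
  *ᴹ-congˡ A X≈Y i j = sum-cong-≋ (λ k → R.*-congˡ (X≈Y k j))

  leftIdeal : Matrix → Pred Matrix (c ⊔ ℓ)
  leftIdeal X Z = ∃[ A ] Z ≈ᴹ A *ᴹ X

  leftIdeal-cong : ∀ {X Y} → X ≈ᴹ Y → leftIdeal X ⊆ leftIdeal Y
  leftIdeal-cong X≈Y (A , Z≈AX) = A , ≈ᴹ-trans Z≈AX (*ᴹ-congˡ A X≈Y)

  Adjacent : Rel Matrix (c ⊔ ℓ)
  Adjacent X Y = ¬ (X ≈ᴹ Y) ×
    (leftIdeal X ⊂ leftIdeal Y ⊎ leftIdeal Y ⊂ leftIdeal X)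

  leftIdealGraph : SimpleGraph c ℓ (c ⊔ ℓ)
  leftIdealGraph = record
    { vertices = matrixSetoid
    ; Adj      = Adjacent
    ; resp     = respʳ , λ Y≈Y′ → adj-sym ∘ respʳ Y≈Y′ ∘ adj-sym
    ; symm     = adj-sym
    ; irrefl   = λ X≈Y adj → proj₁ adj X≈Y
    }
    where
    adj-sym : Symmetric Adjacent
    adj-sym (X≉Y , X⊂Y⊎Y⊂X) = X≉Y ∘ ≈ᴹ-sym , ⊎.swap X⊂Y⊎Y⊂X

    respʳ : ∀ {X Y Y′} → Y ≈ᴹ Y′ → Adjacent X Y → Adjacent X Y′
    respʳ Y≈Y′ (X≉Y , X⊂Y⊎Y⊂X) =
      (λ X≈Y′ → X≉Y (≈ᴹ-trans X≈Y′ (≈ᴹ-sym Y≈Y′))) ,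
      ⊎.map
        (λ (X⊆Y , Y⊈X) → (λ Z∈X → to (X⊆Y Z∈X)) , λ Y′⊆X → Y⊈X λ Z∈Y → Y′⊆X (to Z∈Y))
        (λ (Y⊆X , X⊈Y) → (λ Z∈Y′ → Y⊆X (from Z∈Y′)) , λ X⊆Y′ → X⊈Y λ Z∈X → from (X⊆Y′ Z∈X))
        X⊂Y⊎Y⊂X
      where
      to   = leftIdeal-cong Y≈Y′
      from = leftIdeal-cong (≈ᴹ-sym Y≈Y′)

Γₗᵢ : ∀ {q} → FiniteField q c ℓ → ℕ → SimpleGraph c ℓ (c ⊔ ℓ)
Γₗᵢ F n = Matrices.leftIdealGraph (FiniteField.commutativeRing F) n

{-# OPTIONS --safe #-}

-- Colour a matrix by its rank, computed as the number of pivots of its row space W: the positions i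
-- at which some w ∈ W has its first nonzero entry. If W ⊆ W′ then every pivot of W is a pivot of W′,
-- and if the pivots agree then every w′ ∈ W′ can be cleared from left to right by vectors of W, so
-- that W = W′. Since [X] ⊆ [Y] means inclusion of row spaces, proper inclusion strictly increases the
-- number of pivots, which lies in {0, …, n}. The matrices diag(1,…,1,0,…,0) form a clique of size
-- n + 1, and a clique is never larger than the number of colours.
module Submission where

open import Defs
open import Algebra.Bundles using (CommutativeRing)
import Algebra.Properties.Ring as RingProperties
import Algebra.Properties.Semiring.Sum as SemiringSum
open import Data.Bool.Base using (true; if_then_else_)
open import Data.Fin.Base using (Fin; zero; toℕ; fromℕ; fromℕ<; inject₁; finToFun; funToFin)
  renaming (_<_ to _<ᶠ_)
open import Data.Fin.Induction using (>-weakInduction)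
open import Data.Fin.Properties as Fin
  using (any?; all?; inj⇒≟; injective⇒≤; finToFun-funToFin; punchInᵢ≢i; fromℕ<-cong; fromℕ<-injective;
         toℕ-fromℕ; toℕ-fromℕ<; toℕ-inject₁; toℕ-injective; toℕ<n)
open import Data.Fin.Subset using (Subset; _∈_; ∣_∣) renaming (_⊆_ to _⊆ˢ_)
open import Data.Fin.Subset.Properties using (_∈?_; ∣p∣≤n; p⊆q⇒∣p∣≤∣q∣; p⊂q⇒∣p∣<∣q∣)
open import Data.Nat.Base using (ℕ; suc; s≤s; _+_; _^_; _≤_; _<_)
open import Data.Nat.Properties as ℕ using (_<?_; ≤-antisym; <⇒≢)
open import Data.Product.Base using (_×_; _,_; ∃; proj₁; proj₂)
open import Data.Sum.Base using (inj₁; inj₂)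
open import Data.Vec.Base using (tabulate)
open import Data.Vec.Properties using ([]=⇒lookup; lookup⇒[]=; lookup∘tabulate)
open import Data.Vec.Functional using (Vector; removeAt)
open import Function.Base using (_∘_; case_of_)
open import Function.Bundles using (Func; Bijection; Surjection)
open import Level using (Level; _⊔_)
open import Relation.Binary.Definitions using (tri<; tri≈; tri>)
  renaming (Decidable to Decidable₂)
import Relation.Binary.Reasoning.Setoid as ≈-Reasoning
open import Relation.Binary.PropositionalEquality as ≡ using (_≡_; _≢_)
open import Relation.Nullary using (¬_; Dec; yes; no; does; contradiction)
open import Relation.Nullary.Decidable
  using (map′; dec-true; dec-false; _×-dec_; _→-dec_; ¬?; decidable-stable)
open import Relation.Unary using (Pred; Decidable; _⊆_; _⊂_)

private
  variable
    a p c ℓ e : Level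
    n : ℕ

-- A proper colouring is injective on a clique, so the pigeonhole principle applies. This one
-- inequality supplies both extremality claims of the theorem.
clique≤colours : (Γ : SimpleGraph c ℓ e) → ∀ {k m} → HasClique Γ k → Colourable Γ m → k ≤ m
clique≤colours Γ (v , adj) (f , proper) = injective⇒≤ {f = Func.to f ∘ v} λ {i} {j} eq →
  decidable-stable (i Fin.≟ j) λ i≢j → proper (adj i≢j) eq

-- Finite subsets cut out by decidable predicates.

does-true : {A : Set a} (A? : Dec A) → does A? ≡ true → A
does-true (yes x) _ = x

decSubset : {P : Pred (Fin n) p} → Decidable P → Subset n
decSubset P? = tabulate (does ∘ P?)

module _ {P : Pred (Fin n) p} (P? : Decidable P) where

  ∈-decSubset⁺ : ∀ {i} → P i → i ∈ decSubset P?
  ∈-decSubset⁺ {i} pi =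
    lookup⇒[]= i _ (≡.trans (lookup∘tabulate (does ∘ P?) i) (dec-true (P? i) pi))

  ∈-decSubset⁻ : ∀ {i} → i ∈ decSubset P? → P i
  ∈-decSubset⁻ {i} i∈ =
    does-true (P? i) (≡.trans (≡.sym (lookup∘tabulate (does ∘ P?) i)) ([]=⇒lookup i∈))

-- An element of `q` missing from `p` would make the inclusion strict and the cardinalities
-- different.
∣p∣≡∣q∣⇒q⊆p : {p q : Subset n} → p ⊆ˢ q → ∣ p ∣ ≡ ∣ q ∣ → q ⊆ˢ p
∣p∣≡∣q∣⇒q⊆p {p = p} p⊆q eq {i} i∈q = decidable-stable (i ∈? p) λ i∉p →
  <⇒≢ (p⊂q⇒∣p∣<∣q∣ (p⊆q , i , i∈q , i∉p)) eq

module _ (R : CommutativeRing c ℓ) where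
  open CommutativeRing R renaming (_+_ to _+ᶠ_)
  open SemiringSum semiring using (sum; sum-remove; sum-cong-≋; sum-replicate-zero)
  open ≈-Reasoning setoid

  sum-single : (t : Vector Carrier n) (i : Fin n) → (∀ j → j ≢ i → t j ≈ 0#) → sum t ≈ t i
  sum-single {n = suc n} t i t≈0 = begin
    sum t                     ≈⟨ sum-remove {i = i} t ⟩
    t i +ᶠ sum (removeAt t i)  ≈⟨ +-congˡ (sum-cong-≋ {n} (λ j → t≈0 _ (punchInᵢ≢i i j))) ⟩
    t i +ᶠ sum {n} (λ _ → 0#)  ≈⟨ +-congˡ (sum-replicate-zero n) ⟩
    t i +ᶠ 0#                  ≈⟨ +-identityʳ _ ⟩
    t i                       ∎

module IdealGraph {q : ℕ} (F : FiniteField q c ℓ) (n : ℕ) where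
  open FiniteField F hiding (zero) renaming (_+_ to _+ᶠ_; refl to ≈-refl; trans to ≈-trans)
  open Matrices commutativeRing n
  open SemiringSum semiring
    using (sum-syntax; sum-cong-≋; sum-replicate-zero; ∑-distrib-+; *-distribˡ-sum)
  open RingProperties ring using (-‿distribˡ-*)
  open ≈-Reasoning fieldSetoid

  -- Rows over a finite field and row spaces.

  Row : Set c
  Row = Vector Carrier n

  _≟ᶠ_ : Decidable₂ _≈_
  _≟ᶠ_ = inj⇒≟ (Bijection.injection cardinality)

  -- Rows are coded by the numbers below `q ^ n`, so the search is finite. Decoding inverts encoding
  -- only up to `_≈_`, hence the condition that `P` respects it.
  ∃-row? : {P : Pred Row p} → Decidable P → (∀ {v w} → (∀ i → v i ≈ w i) → P v → P w) → Dec (∃ P)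
  ∃-row? {P = P} P? resp = map′
    (λ (k , Pk) → decode k , Pk)
    (λ (v , Pv) → funToFin (to ∘ v) , resp (λ i → sym (decode-encode v i)) Pv)
    (any? (P? ∘ decode))
    where
    open Bijection cardinality using (to; to⁻; injective; surjection)
    open Surjection surjection using (to∘to⁻)

    decode : Fin (q ^ n) → Row
    decode k = to⁻ ∘ finToFun k

    decode-encode : ∀ v i → decode (funToFin (to ∘ v)) i ≈ v i
    decode-encode v i = injective (≡.trans (to∘to⁻ _) (finToFun-funToFin (to ∘ v) i))

  infixl 7 _·_
  _·_ : Row → Matrix → Row
  (v · X) j = ∑[ k < n ] (v k * X k j)

  ·-congʳ : ∀ X {v w} → (∀ i → v i ≈ w i) → ∀ j → (v · X) j ≈ (w · X) j
  ·-congʳ X v≈w j = sum-cong-≋ (λ k → *-congʳ (v≈w k))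

  RowSpace : Matrix → Pred Row (c ⊔ ℓ)
  RowSpace X w = ∃ λ v → ∀ j → w j ≈ (v · X) j

  RowSpace-0 : ∀ X {w} → (∀ j → w j ≈ 0#) → RowSpace X w
  RowSpace-0 X {w} w≈0 = (λ _ → 0#) , λ j → begin
    w j                       ≈⟨ w≈0 j ⟩
    0#                        ≈⟨ sum-replicate-zero n ⟨
    ∑[ k < n ] 0#             ≈⟨ sum-cong-≋ (λ k → zeroˡ (X k j)) ⟨
    ∑[ k < n ] (0# * X k j)   ∎

  RowSpace-resp : ∀ X {w w′} → (∀ j → w j ≈ w′ j) → RowSpace X w → RowSpace X w′
  RowSpace-resp X w≈w′ (v , w≈vX) = v , λ j → ≈-trans (sym (w≈w′ j)) (w≈vX j)

  RowSpace-axpy : ∀ X {w u} a → RowSpace X w → RowSpace X u → RowSpace X (λ j → w j +ᶠ a * u j)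
  RowSpace-axpy X {w} {u} a (v , w≈vX) (v′ , u≈v′X) = (λ k → v k +ᶠ a * v′ k) , λ j → begin
    w j +ᶠ a * u j
      ≈⟨ +-cong (w≈vX j) (*-congˡ (u≈v′X j)) ⟩
    (v · X) j +ᶠ a * (v′ · X) j
      ≈⟨ +-congˡ (*-distribˡ-sum a (λ k → v′ k * X k j)) ⟩
    (v · X) j +ᶠ ∑[ k < n ] (a * (v′ k * X k j))
      ≈⟨ ∑-distrib-+ (λ k → v k * X k j) (λ k → a * (v′ k * X k j)) ⟨
    ∑[ k < n ] (v k * X k j +ᶠ a * (v′ k * X k j))
      ≈⟨ sum-cong-≋ (λ k → ≈-trans (distribʳ (X k j) (v k) (a * v′ k))
                                   (+-congˡ (*-assoc a (v′ k) (X k j)))) ⟨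
    ∑[ k < n ] ((v k +ᶠ a * v′ k) * X k j) ∎

  RowSpace-axpy⁻ : ∀ X {w u} a → RowSpace X (λ j → w j +ᶠ a * u j) → RowSpace X u → RowSpace X w
  RowSpace-axpy⁻ X {w} {u} a w+au∈ u∈ = RowSpace-resp X
    (λ j → begin
      (w j +ᶠ a * u j) +ᶠ - a * u j     ≈⟨ +-congˡ (-‿distribˡ-* a (u j)) ⟨
      (w j +ᶠ a * u j) +ᶠ - (a * u j)   ≈⟨ +-assoc _ _ _ ⟩
      w j +ᶠ (a * u j +ᶠ - (a * u j))   ≈⟨ +-congˡ (-‿inverseʳ (a * u j)) ⟩
      w j +ᶠ 0#                         ≈⟨ +-identityʳ (w j) ⟩
      w j                               ∎)
    (RowSpace-axpy X (- a) w+au∈ u∈)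

  -- The index only excludes n = 0; a row w becomes a matrix all of whose rows are w.
  leftIdeal⊆⇒RowSpace⊆ : ∀ {X Y} → Fin n → leftIdeal X ⊆ leftIdeal Y → RowSpace X ⊆ RowSpace Y
  leftIdeal⊆⇒RowSpace⊆ i X⊆Y {w} (v , w≈vX) with X⊆Y {λ _ → w} ((λ _ → v) , λ _ → w≈vX)
  ... | B , w≈BY = B i , w≈BY i

  -- Each row of a multiple of `X` lies in the row space of `X`; the coefficient vectors found over
  -- `Y` are stacked into one matrix.
  RowSpace⊆⇒leftIdeal⊆ : ∀ {X Y} → RowSpace X ⊆ RowSpace Y → leftIdeal X ⊆ leftIdeal Y
  RowSpace⊆⇒leftIdeal⊆ X⊆Y {Z} (A , Z≈AX) = proj₁ ∘ row∈ , proj₂ ∘ row∈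
    where
    row∈ = λ i → X⊆Y {Z i} (A i , Z≈AX i)

  -- Pivots and elimination.

  Leading : Fin n → Pred Row ℓ
  Leading i w = ¬ (w i ≈ 0#) × (∀ j → j <ᶠ i → w j ≈ 0#)

  leading? : ∀ i → Decidable (Leading i)
  leading? i w = ¬? (w i ≟ᶠ 0#) ×-dec all? (λ j → (j Fin.<? i) →-dec (w j ≟ᶠ 0#))

  Leading-resp : ∀ i {v w} → (∀ j → v j ≈ w j) → Leading i v → Leading i w
  Leading-resp i v≈w (vi≉0 , v≈0) =
    (λ wi≈0 → vi≉0 (≈-trans (v≈w i) wi≈0)) , λ j j<i → ≈-trans (sym (v≈w j)) (v≈0 j j<i)

  Pivot : Matrix → Pred (Fin n) (c ⊔ ℓ)
  Pivot X i = ∃ λ w → RowSpace X w × Leading i w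

  pivot? : ∀ X → Decidable (Pivot X)
  pivot? X i = map′
    (λ (v , lead) → v · X , (v , λ _ → ≈-refl) , lead)
    (λ (w , (v , w≈vX) , lead) → v , Leading-resp i w≈vX lead)
    -- The search runs over coefficient vectors `v` instead of elements `w`, so that membership in
    -- the row space is automatic.
    (∃-row? (λ v → leading? i (v · X)) (λ v≈w → Leading-resp i (·-congʳ X v≈w)))

  clear : ∀ x {y} → ¬ (y ≈ 0#) → ∃ λ a → x +ᶠ a * y ≈ 0#
  clear x {y} y≉0 with ≉0⇒inverse y y≉0
  ... | y⁻¹ , y⁻¹*y≈1 , _ = - (x * y⁻¹) , (begin
    x +ᶠ - (x * y⁻¹) * y     ≈⟨ +-congˡ (-‿distribˡ-* (x * y⁻¹) y) ⟨
    x +ᶠ - ((x * y⁻¹) * y)   ≈⟨ +-congˡ (-‿cong (*-assoc x y⁻¹ y)) ⟩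
    x +ᶠ - (x * (y⁻¹ * y))   ≈⟨ +-congˡ (-‿cong (*-congˡ y⁻¹*y≈1)) ⟩
    x +ᶠ - (x * 1#)          ≈⟨ +-congˡ (-‿cong (*-identityʳ x)) ⟩
    x +ᶠ - x                 ≈⟨ -‿inverseʳ x ⟩
    0#                       ∎)

  module _ {X Y} (X⊆Y : RowSpace X ⊆ RowSpace Y) (pivots : Pivot Y ⊆ Pivot X) where

    private
      -- Induction hypothesis for left-to-right elimination, proved downwards in `k`: at `n` only
      -- the zero row is left, and at `0` it is the full inclusion.
      VanishingBelow : Fin (suc n) → Set (c ⊔ ℓ)
      VanishingBelow k = ∀ w → (∀ j → toℕ j < toℕ k → w j ≈ 0#) → RowSpace Y w → RowSpace X w

      below-n : VanishingBelow (fromℕ n)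
      below-n w w≈0 _ = RowSpace-0 X λ j → w≈0 j (≡.subst (toℕ j <_) (≡.sym (toℕ-fromℕ n)) (toℕ<n j))

      extend : ∀ i {w : Row} → (∀ j → j <ᶠ i → w j ≈ 0#) → w i ≈ 0# →
        ∀ j → toℕ j < suc (toℕ i) → w j ≈ 0#
      extend i w≈0 wi≈0 j (s≤s j≤i) with j Fin.≟ i
      ... | yes ≡.refl = wi≈0
      ... | no j≢i = w≈0 j (ℕ.≤∧≢⇒< j≤i (j≢i ∘ toℕ-injective))

      step : ∀ i → VanishingBelow (Fin.suc i) → VanishingBelow (inject₁ i)
      step i rec w w≈0 w∈Y rewrite toℕ-inject₁ i with w i ≟ᶠ 0#
      ... | yes wi≈0 = rec w (extend i {w} w≈0 wi≈0) w∈Y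
      -- Here `w` itself shows that `i` is a pivot of `Y`, hence of `X`. Some `u` in the row space
      -- of `X` leads at `i`, and adding `a * u` to `w` clears entry `i` without disturbing the
      -- zeros before it.
      ... | no wi≉0 with pivots (w , w∈Y , wi≉0 , w≈0)
      ... | u , u∈X , ui≉0 , u≈0 with clear (w i) ui≉0
      ... | a , cleared = RowSpace-axpy⁻ X a
        (rec w′ (extend i {w′} vanish cleared) (RowSpace-axpy Y a w∈Y (X⊆Y u∈X))) u∈X
        where
        w′ : Row
        w′ j = w j +ᶠ a * u j

        vanish : ∀ j → j <ᶠ i → w′ j ≈ 0#
        vanish j j<i = begin
          w j +ᶠ a * u j  ≈⟨ +-cong (w≈0 j j<i) (*-congˡ (u≈0 j j<i)) ⟩
          0# +ᶠ a * 0#    ≈⟨ +-identityˡ _ ⟩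
          a * 0#          ≈⟨ zeroʳ a ⟩
          0#              ∎

    samePivots⇒RowSpace⊇ : RowSpace Y ⊆ RowSpace X
    samePivots⇒RowSpace⊇ {w} = >-weakInduction VanishingBelow below-n step zero w (λ _ ())

  -- The colouring by rank.

  pivots : Matrix → Subset n
  pivots X = decSubset (pivot? X)

  rank : Matrix → ℕ
  rank X = ∣ pivots X ∣

  leftIdeal⊆⇒pivots⊆ : ∀ {X Y} → leftIdeal X ⊆ leftIdeal Y → pivots X ⊆ˢ pivots Y
  leftIdeal⊆⇒pivots⊆ {X} {Y} X⊆Y {i} i∈ with ∈-decSubset⁻ (pivot? X) i∈
  ... | w , w∈X , lead = ∈-decSubset⁺ (pivot? Y) (w , leftIdeal⊆⇒RowSpace⊆ i X⊆Y w∈X , lead)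

  rank-cong : ∀ {X Y} → X ≈ᴹ Y → rank X ≡ rank Y
  rank-cong X≈Y = ≤-antisym (rank-mono X≈Y) (rank-mono (≈ᴹ-sym X≈Y))
    where
    rank-mono : ∀ {X Y} → X ≈ᴹ Y → rank X ≤ rank Y
    rank-mono X≈Y = p⊆q⇒∣p∣≤∣q∣ (leftIdeal⊆⇒pivots⊆ (leftIdeal-cong X≈Y))

  -- The pivots of `X` are among those of `Y`; equal rank would make the two sets coincide, and
  -- elimination would then give the reverse inclusion of ideals.
  leftIdeal⊂⇒rank≢ : Fin n → ∀ {X Y} → leftIdeal X ⊂ leftIdeal Y → rank X ≢ rank Y
  leftIdeal⊂⇒rank≢ i {X} {Y} (X⊆Y , Y⊈X) eq = Y⊈X (RowSpace⊆⇒leftIdeal⊆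
    (samePivots⇒RowSpace⊇ (leftIdeal⊆⇒RowSpace⊆ i X⊆Y)
      (∈-decSubset⁻ (pivot? X) ∘ ∣p∣≡∣q∣⇒q⊆p (leftIdeal⊆⇒pivots⊆ X⊆Y) eq ∘ ∈-decSubset⁺ (pivot? Y))))

  colourable : Fin n → Colourable leftIdealGraph (suc n)
  colourable i =
    record { to = λ X → fromℕ< (rank<1+n X) ; cong = λ X≈Y → fromℕ<-cong _ _ (rank-cong X≈Y) _ _ } ,
    λ (_ , X⊂Y⊎Y⊂X) eq → case X⊂Y⊎Y⊂X of λ where
      (inj₁ X⊂Y) → leftIdeal⊂⇒rank≢ i X⊂Y (fromℕ<-injective _ _ _ _ eq)
      (inj₂ Y⊂X) → leftIdeal⊂⇒rank≢ i Y⊂X (≡.sym (fromℕ<-injective _ _ _ _ eq))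
    where
    rank<1+n : ∀ X → rank X < suc n
    rank<1+n X = s≤s (∣p∣≤n (pivots X))

  -- The clique of truncated identity matrices.

  truncatedIdentity : ℕ → Matrix
  truncatedIdentity k i j = if does ((i Fin.≟ j) ×-dec (toℕ j <? k)) then 1# else 0#

  truncatedIdentity-1 : ∀ k j → toℕ j < k → truncatedIdentity k j j ≈ 1#
  truncatedIdentity-1 k j j<k
    rewrite dec-true ((j Fin.≟ j) ×-dec (toℕ j <? k)) (≡.refl , j<k) = ≈-refl

  truncatedIdentity-0 : ∀ k i j → ¬ (i ≡ j × toℕ j < k) → truncatedIdentity k i j ≈ 0#
  truncatedIdentity-0 k i j ¬eq rewrite dec-false ((i Fin.≟ j) ×-dec (toℕ j <? k)) ¬eq = ≈-refl

  -- The second factor is diagonal, so only the summand at `j` survives: right multiplication keeps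
  -- the first `k` columns of `A` and erases the others.
  *ᴹ-truncatedIdentity : ∀ A k i j →
    (A *ᴹ truncatedIdentity k) i j ≈ A i j * truncatedIdentity k j j
  *ᴹ-truncatedIdentity A k i j = sum-single commutativeRing _ j λ m m≢j →
    ≈-trans (*-congˡ (truncatedIdentity-0 k m j (m≢j ∘ proj₁))) (zeroʳ (A i m))

  VanishingFrom : ℕ → Pred Matrix ℓ
  VanishingFrom k Z = ∀ i j → ¬ (toℕ j < k) → Z i j ≈ 0#

  -- With its converse below, this identifies the ideal with the matrices whose columns from `k` on
  -- are zero, so that comparing ideals reduces to comparing bounds.
  leftIdeal⇒vanishing : ∀ k → leftIdeal (truncatedIdentity k) ⊆ VanishingFrom k
  leftIdeal⇒vanishing k {Z} (A , Z≈AE) i j j≮k = begin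
    Z i j                              ≈⟨ Z≈AE i j ⟩
    (A *ᴹ truncatedIdentity k) i j     ≈⟨ *ᴹ-truncatedIdentity A k i j ⟩
    A i j * truncatedIdentity k j j    ≈⟨ *-congˡ (truncatedIdentity-0 k j j (j≮k ∘ proj₂)) ⟩
    A i j * 0#                         ≈⟨ zeroʳ _ ⟩
    0#                                 ∎

  vanishing⇒leftIdeal : ∀ k → VanishingFrom k ⊆ leftIdeal (truncatedIdentity k)
  -- `Z` is its own coefficient matrix, since the columns erased are already zero.
  vanishing⇒leftIdeal k {Z} Z≈0 = Z , λ i j → sym (≈-trans (*ᴹ-truncatedIdentity Z k i j) (absorb i j))
    where
    absorb : ∀ i j → Z i j * truncatedIdentity k j j ≈ Z i j
    absorb i j with toℕ j <? k
    ... | yes j<k = ≈-trans (*-congˡ (truncatedIdentity-1 k j j<k)) (*-identityʳ _)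
    ... | no j≮k = ≈-trans (*-congʳ (Z≈0 i j j≮k)) (≈-trans (zeroˡ _) (sym (Z≈0 i j j≮k)))

  truncatedIdentity-⊂ : ∀ {k m} → k < m → m ≤ n →
    leftIdeal (truncatedIdentity k) ⊂ leftIdeal (truncatedIdentity m)
  truncatedIdentity-⊂ {k} {m} k<m m≤n =
    (λ Z∈k → vanishing⇒leftIdeal m λ i j j≮m →
      leftIdeal⇒vanishing k Z∈k i j (λ j<k → j≮m (ℕ.<-trans j<k k<m))) ,
    -- Properness is seen at the diagonal entry in position `k`, which exists because `k < m ≤ n`:
    -- it is `1#` in `truncatedIdentity m` but zero throughout the smaller ideal.
    λ m⊆k → 1≉0 (≈-trans (sym (truncatedIdentity-1 m j (≡.subst (_< m) (≡.sym j≡k) k<m)))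
      (leftIdeal⇒vanishing k (m⊆k m∈m) j j (ℕ.<-irrefl j≡k)))
    where
    k<n = ℕ.<-≤-trans k<m m≤n
    j = fromℕ< k<n
    j≡k = toℕ-fromℕ< k<n

    m∈m = vanishing⇒leftIdeal m λ i j j≮m → truncatedIdentity-0 m i j (j≮m ∘ proj₂)

  leftIdeal⊂⇒≉ : ∀ {X Y} → leftIdeal X ⊂ leftIdeal Y → ¬ (X ≈ᴹ Y)
  leftIdeal⊂⇒≉ (_ , Y⊈X) X≈Y = Y⊈X (leftIdeal-cong (≈ᴹ-sym X≈Y))

  hasClique : HasClique leftIdealGraph (suc n)
  -- The truncation bound takes all values from `0` to `n`, which gives `suc n` matrices.
  hasClique = truncatedIdentity ∘ toℕ , λ {i} {j} i≢j → adjacent i j i≢j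
    where
    adjacent : ∀ i j → i ≢ j → Adjacent (truncatedIdentity (toℕ i)) (truncatedIdentity (toℕ j))
    adjacent i j i≢j with Fin.<-cmp i j
    ... | tri< i<j _ _ = leftIdeal⊂⇒≉ i⊂j , inj₁ i⊂j
      where i⊂j = truncatedIdentity-⊂ i<j (ℕ.≤-pred (toℕ<n j))
    ... | tri≈ _ i≡j _ = contradiction i≡j i≢j
    ... | tri> _ _ j<i = leftIdeal⊂⇒≉ j⊂i ∘ ≈ᴹ-sym , inj₂ j⊂i
      where j⊂i = truncatedIdentity-⊂ j<i (ℕ.≤-pred (toℕ<n i))

theorem4p2 : ∀ {c ℓ : Level} (q : ℕ) → PrimePower q → (F : FiniteField q c ℓ) →
    (n : ℕ) → 1 ≤ n →
    IsChromaticNumber (Γₗᵢ F n) (n + 1) × IsCliqueNumber (Γₗᵢ F n) (n + 1)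
theorem4p2 q _ F n 1≤n rewrite ℕ.+-comm n 1 =
  -- The clique bounds every colouring from below, and the colouring bounds every clique from above.
  (colouring , λ _ → clique≤colours Γ clique) ,
  (clique , λ _ clique′ → clique≤colours Γ clique′ colouring)
  where
  Γ = Γₗᵢ F n
  clique = IdealGraph.hasClique F n
  colouring = IdealGraph.colourable F n (fromℕ< 1≤n)
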